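{- Assume the univalence axiom. Let $A\xrightarrow{i}E\xrightarrow{p}B$ be a short exact sequence of abelian groups. For any abelian group $G$, the pointed maps given by pullback \[ \mathrm{AbSES}(B,G)\xrightarrow{p^*}\mathrm{AbSES}(E,G)\xrightarrow{i^*}\mathrm{AbSES}(A,G) \] form a fibre sequence.
   Context: We work in homotopy type theory with univalence. For abelian groups $X,Y$, $\mathrm{AbSES}(Y,X)$ is the type of short exact sequences $(M,j,q)$: $M$ an abelian group (in the same universe as $X,Y$), $j:X\to M$ injective, $q:M\to Y$ surjective, $q\circ j=0$, and $X\to\ker q$ surjective; it is pointed by the trivial sequence $X\to X\oplus Y\to Y$. For a homomorphism $g:Y'\to Y$, the pullback $g^*:\mathrm{AbSES}(Y,X)\to\mathrm{AbSES}(Y',X)$ replaces $M$ by $M\times_Y Y'=\{(m,y')\mid q(m)=g(y')\}$ with inclusion $x\mapsto(j(x),0)$ and projection $(m,y')\mapsto y'$; it is a pointed map. A sequence of pointed maps $F\xrightarrow{u}T\xrightarrow{v}S$ is a fibre sequence if $v\circ u$ is pointed-homotopic to the constant map and the induced map $F\to\mathrm{fib}(v)$ (the homotopy fibre of $v$ over the base point) is an equivalence. -}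

{-# OPTIONS --without-K #-}
module Defs where

open import Algebra.Bundles using (AbelianGroup; RawGroup)
open import Algebra.Morphism.Structures using (IsGroupHomomorphism)
open import Algebra.Properties.Group using (ε⁻¹≈ε)
open import Algebra.Structures using (IsAbelianGroup)
open import Axiom.Extensionality.Propositional using (Extensionality; lower-extensionality; implicit-extensionality)
open import Axiom.UniquenessOfIdentityProofs using (UIP; module Constant⇒UIP)
open import Data.Product.Base using (Σ; Σ-syntax; _×_; _,_; proj₁; proj₂)
open import Data.Product.Properties using (×-≡,≡→≡)
open import Function.Base using (id; _∘_; _$_)
open import Function.Definitions using (Injective)
open import Level using (Level; _⊔_; Setω) renaming (suc to lsuc)
open import Relation.Binary.PropositionalEquality using (_≡_; refl; sym; trans; cong; cong₂; cong-app; subst; isEquivalence)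
open import Relation.Nullary.Irrelevant using (Irrelevant)

private
  variable
    a b c k ℓ : Level

------------------------------------------------------------------------
-- Equivalences and univalence

IsContr : Set a → Set a
IsContr A = Σ[ x ∈ A ] (∀ y → x ≡ y)

fibre : {A : Set a} {B : Set b} → (A → B) → B → Set (a ⊔ b)
fibre {A = A} f y = Σ[ x ∈ A ] f x ≡ y

IsEquiv : {A : Set a} {B : Set b} → (A → B) → Set (a ⊔ b)
IsEquiv f = ∀ y → IsContr (fibre f y)

_≃_ : Set a → Set b → Set (a ⊔ b)
A ≃ B = Σ[ f ∈ (A → B) ] IsEquiv f

id-isEquiv : {A : Set a} → IsEquiv (id {A = A})
id-isEquiv y = (y , refl) , λ { (_ , refl) → refl }

idToEquiv : {A B : Set a} → A ≡ B → A ≃ B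
idToEquiv refl = id , id-isEquiv

Univalence : Setω
Univalence = ∀ ℓ (A B : Set ℓ) → IsEquiv (idToEquiv {A = A} {B = B})

-- The library's `Irrelevant` and `UIP` are used throughout for "is a
-- proposition" and "is a set".

-- The propositional truncation, impredicatively encoded.  For A : Set a
-- this is logically equivalent to any proposition in Set a having the
-- universal property of the truncation of A, and `∥∥-irrelevant` shows
-- that it is itself a proposition.

∥_∥ : Set a → Set (lsuc a)
∥_∥ {a} A = (P : Set a) → Irrelevant P → (A → P) → P

∥∥-map : {A : Set a} {B : Set a} → (A → B) → ∥ A ∥ → ∥ B ∥
∥∥-map f t P irr h = t P irr (h ∘ f)

-- The library's `Surjective` asks for a chosen section, so it is not used here.

IsSurjective : {A : Set a} {B : Set b} → (A → B) → Set (lsuc (a ⊔ b))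
IsSurjective f = ∀ y → ∥ fibre f y ∥

------------------------------------------------------------------------
-- Propositions and sets

Irrelevant⇒UIP : {A : Set a} → Irrelevant A → UIP A
Irrelevant⇒UIP irr = Constant⇒UIP.≡-irrelevant (λ {x} {y} _ → irr x y) (λ _ _ → refl)

×-irrelevant : {A : Set a} {B : Set b} → Irrelevant A → Irrelevant B → Irrelevant (A × B)
×-irrelevant irrA irrB (x , y) (x′ , y′) = cong₂ _,_ (irrA x x′) (irrB y y′)

retract-irrelevant : {A : Set a} {B : Set b} (r : B → A) (s : A → B) →
                     (∀ x → r (s x) ≡ x) → Irrelevant B → Irrelevant A
retract-irrelevant r s rs irr x y =
  trans (sym (rs x)) (trans (cong r (irr (s x) (s y))) (rs y))

Σ-≡-irrelevant : {A : Set a} {B : A → Set b} → (∀ x → Irrelevant (B x)) →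
                 {x y : Σ A B} → proj₁ x ≡ proj₁ y → x ≡ y
Σ-≡-irrelevant irr {x , _} {_ , _} refl = cong (x ,_) (irr x _ _)

×-UIP : {A : Set a} {B : Set b} → UIP A → UIP B → UIP (A × B)
×-UIP uA uB = Constant⇒UIP.≡-irrelevant
  (λ p → ×-≡,≡→≡ (cong proj₁ p , cong proj₂ p))
  (λ p q → cong ×-≡,≡→≡ (cong₂ _,_ (uA (cong proj₁ p) (cong proj₁ q))
                                   (uB (cong proj₂ p) (cong proj₂ q))))

Σ-UIP : {A : Set a} {B : A → Set b} → UIP A → (∀ x → Irrelevant (B x)) → UIP (Σ A B)
Σ-UIP uA irr = Constant⇒UIP.≡-irrelevant
  (λ p → Σ-≡-irrelevant irr (cong proj₁ p))
  (λ p q → cong (Σ-≡-irrelevant irr) (uA (cong proj₁ p) (cong proj₁ q)))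

inverse⇒isEquiv : {A : Set a} {B : Set b} → UIP B → (f : A → B) (g : B → A) →
                  (∀ y → f (g y) ≡ y) → (∀ x → g (f x) ≡ x) → IsEquiv f
inverse⇒isEquiv uB f g fg gf y =
  (g y , fg y) ,
  λ { (x , p) → Σ-≡-irrelevant (λ _ → uB) (trans (cong g (sym p)) (gf x)) }

------------------------------------------------------------------------
-- Consequences of univalence

equiv-ind : Univalence → {A : Set ℓ} (P : (B : Set ℓ) → (A → B) → Set k) →
            P A id → ∀ {B} (f : A → B) → IsEquiv f → P B f
equiv-ind {ℓ} ua {A} P base {B} f e = subst (P B ∘ proj₁) (proj₂ centre) (transported (proj₁ centre))
  where
  centre : fibre (idToEquiv {A = A} {B = B}) (f , e)
  centre = proj₁ (ua ℓ A B (f , e))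

  transported : ∀ {C} (p : A ≡ C) → P C (proj₁ (idToEquiv p))
  transported refl = base

∘-isEquiv : Univalence → {A B C : Set ℓ} (f : A → B) → IsEquiv f →
            IsEquiv {A = C → A} (f ∘_)
∘-isEquiv ua {C = C} = equiv-ind ua (λ B f → IsEquiv {A = C → _} (f ∘_)) id-isEquiv

proj₁-isEquiv : {A : Set a} {B : A → Set b} → (∀ x → IsContr (B x)) → IsEquiv (proj₁ {B = B})
proj₁-isEquiv c x =
  ((x , proj₁ (c x)) , refl) ,
  λ { ((_ , y) , refl) → cong (λ z → (x , z) , refl) (proj₂ (c x) y) }

Π-isContr : Univalence → {A : Set ℓ} {B : A → Set ℓ} → (∀ x → IsContr (B x)) → IsContr (∀ x → B x)
Π-isContr ua {A} {B} c = retract (proj₁ sections) , λ f → cong retract (proj₂ sections (section f))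
  where
  sections : IsContr (fibre {A = A → Σ A B} (proj₁ ∘_) id)
  sections = ∘-isEquiv ua proj₁ (proj₁-isEquiv c) id

  retract : fibre {A = A → Σ A B} (proj₁ ∘_) id → ∀ x → B x
  retract (h , p) x = subst B (cong-app p x) (proj₂ (h x))

  section : (∀ x → B x) → fibre {A = A → Σ A B} (proj₁ ∘_) id
  section f = (λ x → x , f x) , refl

extensionality : Univalence → ∀ a b → Extensionality a b
extensionality ua a b = lower-extensionality b a homogeneous
  where
  homogeneous : Extensionality (a ⊔ b) (a ⊔ b)
  homogeneous {B = B} {f} {g} f≗g =
    cong (λ (h : ∀ x → Σ[ y ∈ B x ] f x ≡ y) x → proj₁ (h x))
         (trans (sym (proj₂ total λ x → f x , refl)) (proj₂ total λ x → g x , f≗g x))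
    where
    total : IsContr (∀ x → Σ[ y ∈ B x ] f x ≡ y)
    total = Π-isContr ua (λ x → (f x , refl) , λ { (_ , refl) → refl })

Π-irrelevant : Univalence → {A : Set a} {B : A → Set b} →
               (∀ x → Irrelevant (B x)) → Irrelevant (∀ x → B x)
Π-irrelevant ua irr f g = extensionality ua _ _ (λ x → irr x (f x) (g x))

Πᵢ-irrelevant : Univalence → {A : Set a} {B : A → Set b} →
                (∀ x → Irrelevant (B x)) → Irrelevant (∀ {x} → B x)
Πᵢ-irrelevant ua irr f g =
  implicit-extensionality (extensionality ua _ _) (λ {x} → irr x (f {x}) (g {x}))

UIP-irrelevant : Univalence → {A : Set a} → Irrelevant (UIP A)
UIP-irrelevant ua u =
  Πᵢ-irrelevant ua (λ _ → Πᵢ-irrelevant ua λ _ → Π-irrelevant ua λ _ → Π-irrelevant ua λ _ →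
    Irrelevant⇒UIP u) u

∥∥-irrelevant : Univalence → {A : Set a} → Irrelevant ∥ A ∥
∥∥-irrelevant ua = Π-irrelevant ua λ _ → λ t u → extensionality ua _ _ λ irr →
  Π-irrelevant ua (λ _ → irr) (t irr) (u irr)

------------------------------------------------------------------------
-- Abelian groups

-- The library's `AbelianGroup` carries an arbitrary equivalence relation;
-- here equality is the identity type and the carrier is a set.

record AbGroup ℓ : Set (lsuc ℓ) where
  constructor mkAbGroup
  infixl 6 _+_
  field
    Carrier        : Set ℓ
    _+_            : Carrier → Carrier → Carrier
    0#             : Carrier
    -_             : Carrier → Carrier
    isSet          : UIP Carrier
    isAbelianGroup : IsAbelianGroup _≡_ _+_ 0# -_

  abelianGroup : AbelianGroup ℓ ℓ
  abelianGroup = record { isAbelianGroup = isAbelianGroup }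

  open AbelianGroup abelianGroup public
    using (group; rawGroup; assoc; comm; identityˡ; identityʳ; inverseˡ; inverseʳ)

open AbGroup using (Carrier; isSet)

record _→ᴳ_ (X Y : AbGroup ℓ) : Set ℓ where
  constructor mkHom
  field
    ⟦_⟧   : Carrier X → Carrier Y
    isHom : IsGroupHomomorphism (AbGroup.rawGroup X) (AbGroup.rawGroup Y) ⟦_⟧

  open IsGroupHomomorphism isHom public using (homo; ε-homo; ⁻¹-homo)

open _→ᴳ_ using (⟦_⟧)

mkIsAbelianGroup : {A : Set a} {_+_ : A → A → A} {0# : A} { -_ : A → A} →
                   (∀ x y z → ((x + y) + z) ≡ (x + (y + z))) →
                   (∀ x → (0# + x) ≡ x) → (∀ x → ((- x) + x) ≡ 0#) →
                   (∀ x y → (x + y) ≡ (y + x)) →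
                   IsAbelianGroup _≡_ _+_ 0# -_
mkIsAbelianGroup {_+_ = _+_} { -_ = -_} as idˡ invˡ cm = record
  { isGroup = record
    { isMonoid = record
      { isSemigroup = record
        { isMagma = record { isEquivalence = isEquivalence ; ∙-cong = cong₂ _+_ }
        ; assoc = as }
      ; identity = idˡ , λ x → trans (cm x _) (idˡ x) }
    ; inverse = invˡ , λ x → trans (cm x _) (invˡ x)
    ; ⁻¹-cong = cong -_ }
  ; comm = cm }

mkIsHom : (X Y : AbGroup ℓ) {f : Carrier X → Carrier Y} →
          let open AbGroup X using () renaming (_+_ to _+₁_; 0# to 0₁; -_ to -₁_)
              open AbGroup Y using () renaming (_+_ to _+₂_; 0# to 0₂; -_ to -₂_) in
          (∀ x y → f (x +₁ y) ≡ f x +₂ f y) → f 0₁ ≡ 0₂ → (∀ x → f (-₁ x) ≡ -₂ f x) →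
          IsGroupHomomorphism (AbGroup.rawGroup X) (AbGroup.rawGroup Y) f
mkIsHom _ _ {f} h e i = record
  { isMonoidHomomorphism = record
    { isMagmaHomomorphism = record { isRelHomomorphism = record { cong = cong f } ; homo = h }
    ; ε-homo = e }
  ; ⁻¹-homo = i }

isAbelianGroup-irrelevant : Univalence → {A : Set a} → UIP A →
  {_+_ : A → A → A} {0# : A} { -_ : A → A} → Irrelevant (IsAbelianGroup _≡_ _+_ 0# -_)
isAbelianGroup-irrelevant ua {A} u {_+_} {0#} { -_} = retract-irrelevant from to (λ _ → refl) $
  ×-irrelevant (Π λ _ → u) $ ×-irrelevant (Π λ _ → Π λ _ → Π λ _ → u) $
  ×-irrelevant (Π λ _ → Π λ _ → Π λ _ → Π λ _ → Π λ _ → u) $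
  ×-irrelevant (Π λ _ → Π λ _ → Π λ _ → Π λ _ → Π λ _ → Π λ _ → u) $
  ×-irrelevant (Π λ _ → Π λ _ → Π λ _ → u) $
  ×-irrelevant (×-irrelevant (Π λ _ → u) (Π λ _ → u)) $
  ×-irrelevant (×-irrelevant (Π λ _ → u) (Π λ _ → u)) $
  ×-irrelevant (Π λ _ → Π λ _ → Π λ _ → u) (Π λ _ → Π λ _ → u)
  where
  Π : {B : Set b} {C : B → Set c} → (∀ x → Irrelevant (C x)) → Irrelevant (∀ x → C x)
  Π = Π-irrelevant ua

  Laws : Set _
  Laws = (∀ x → x ≡ x) × (∀ x y → x ≡ y → y ≡ x) × (∀ x y z → x ≡ y → y ≡ z → x ≡ z) ×
         (∀ x y z w → x ≡ y → z ≡ w → (x + z) ≡ (y + w)) ×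
         (∀ x y z → ((x + y) + z) ≡ (x + (y + z))) ×
         ((∀ x → (0# + x) ≡ x) × (∀ x → (x + 0#) ≡ x)) ×
         ((∀ x → ((- x) + x) ≡ 0#) × (∀ x → (x + (- x)) ≡ 0#)) ×
         (∀ x y → x ≡ y → (- x) ≡ (- y)) × (∀ x y → (x + y) ≡ (y + x))

  to : IsAbelianGroup _≡_ _+_ 0# -_ → Laws
  to L = (λ _ → L.refl) , (λ _ _ → L.sym) , (λ _ _ _ → L.trans) , (λ _ _ _ _ → L.∙-cong) ,
         L.assoc , L.identity , L.inverse , (λ _ _ → L.⁻¹-cong) , L.comm
    where module L = IsAbelianGroup L

  from : Laws → IsAbelianGroup _≡_ _+_ 0# -_
  from (r , s , t , c , as , idt , inv , ic , cm) = record
    { isGroup = record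
      { isMonoid = record
        { isSemigroup = record
          { isMagma = record
            { isEquivalence = record { refl = r _ ; sym = s _ _ ; trans = t _ _ _ }
            ; ∙-cong = c _ _ _ _ }
          ; assoc = as }
        ; identity = idt }
      ; inverse = inv
      ; ⁻¹-cong = ic _ _ }
    ; comm = cm }

isHom-irrelevant : Univalence → (X Y : AbGroup ℓ) {f : Carrier X → Carrier Y} →
                   Irrelevant (IsGroupHomomorphism (AbGroup.rawGroup X) (AbGroup.rawGroup Y) f)
isHom-irrelevant ua X Y {f} = retract-irrelevant from to (λ _ → refl) $
  ×-irrelevant (Π λ _ → Π λ _ → Π λ _ → Y.isSet) $ ×-irrelevant (Π λ _ → Π λ _ → Y.isSet) $
  ×-irrelevant Y.isSet (Π λ _ → Y.isSet)
  where
  module X = AbGroup X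
  module Y = AbGroup Y

  Π : {B : Set b} {C : B → Set c} → (∀ x → Irrelevant (C x)) → Irrelevant (∀ x → C x)
  Π = Π-irrelevant ua

  Laws : Set _
  Laws = (∀ x y → x ≡ y → f x ≡ f y) × (∀ x y → f (x X.+ y) ≡ f x Y.+ f y) ×
         f X.0# ≡ Y.0# × (∀ x → f (X.- x) ≡ Y.- f x)

  to : IsGroupHomomorphism X.rawGroup Y.rawGroup f → Laws
  to h = (λ _ _ → h.⟦⟧-cong) , h.homo , h.ε-homo , h.⁻¹-homo
    where module h = IsGroupHomomorphism h

  from : Laws → IsGroupHomomorphism X.rawGroup Y.rawGroup f
  from (c , h , e , i) = record
    { isMonoidHomomorphism = record
      { isMagmaHomomorphism = record { isRelHomomorphism = record { cong = c _ _ } ; homo = h }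
      ; ε-homo = e }
    ; ⁻¹-homo = i }

infixr 6 _⊕_

_⊕_ : AbGroup ℓ → AbGroup ℓ → AbGroup ℓ
X ⊕ Y = record
  { Carrier = Carrier X × Carrier Y
  ; _+_ = λ { (x , y) (x′ , y′) → (x X.+ x′) , (y Y.+ y′) }
  ; 0# = X.0# , Y.0#
  ; -_ = λ { (x , y) → (X.- x) , (Y.- y) }
  ; isSet = ×-UIP X.isSet Y.isSet
  ; isAbelianGroup = mkIsAbelianGroup
      (λ _ _ _ → cong₂ _,_ (X.assoc _ _ _) (Y.assoc _ _ _))
      (λ _ → cong₂ _,_ (X.identityˡ _) (Y.identityˡ _))
      (λ _ → cong₂ _,_ (X.inverseˡ _) (Y.inverseˡ _))
      (λ _ _ → cong₂ _,_ (X.comm _ _) (Y.comm _ _))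
  }
  where
  module X = AbGroup X
  module Y = AbGroup Y

fibreProduct : {M Y Y′ : AbGroup ℓ} → M →ᴳ Y → Y′ →ᴳ Y → AbGroup ℓ
fibreProduct {M = M} {Y} {Y′} q g = record
  { Carrier = Σ[ (m , y′) ∈ Carrier N ] ⟦ q ⟧ m ≡ ⟦ g ⟧ y′
  ; _+_ = λ { (n₁ , e₁) (n₂ , e₂) → (n₁ N.+ n₂) ,
      trans (q.homo _ _) (trans (cong₂ Y._+_ e₁ e₂) (sym (g.homo _ _))) }
  ; 0# = N.0# , trans q.ε-homo (sym g.ε-homo)
  ; -_ = λ { (n , e) → (N.- n) , trans (q.⁻¹-homo _) (trans (cong Y.-_ e) (sym (g.⁻¹-homo _))) }
  ; isSet = Σ-UIP N.isSet (λ _ → Y.isSet)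
  ; isAbelianGroup = mkIsAbelianGroup
      (λ _ _ _ → equal (N.assoc _ _ _))
      (λ _ → equal (N.identityˡ _))
      (λ _ → equal (N.inverseˡ _))
      (λ _ _ → equal (N.comm _ _))
  }
  where
  N = M ⊕ Y′
  module N = AbGroup N
  module Y = AbGroup Y
  module q = _→ᴳ_ q
  module g = _→ᴳ_ g

  equal : {x y : Σ[ (m , y′) ∈ Carrier N ] ⟦ q ⟧ m ≡ ⟦ g ⟧ y′} → proj₁ x ≡ proj₁ y → x ≡ y
  equal = Σ-≡-irrelevant (λ _ → Y.isSet)

------------------------------------------------------------------------
-- Short exact sequences

Kernel : {M Y : AbGroup ℓ} → M →ᴳ Y → Set ℓ
Kernel {M = M} {Y} q = Σ[ m ∈ Carrier M ] ⟦ q ⟧ m ≡ AbGroup.0# Y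

toKernel : {X M Y : AbGroup ℓ} (j : X →ᴳ M) (q : M →ᴳ Y) →
           (∀ x → ⟦ q ⟧ (⟦ j ⟧ x) ≡ AbGroup.0# Y) → Carrier X → Kernel q
toKernel j q z x = ⟦ j ⟧ x , z x

record IsShortExact {X M Y : AbGroup ℓ} (j : X →ᴳ M) (q : M →ᴳ Y) : Set (lsuc ℓ) where
  constructor mkIsShortExact
  field
    injective  : Injective _≡_ _≡_ ⟦ j ⟧
    surjective : IsSurjective ⟦ q ⟧
    zero       : ∀ x → ⟦ q ⟧ (⟦ j ⟧ x) ≡ AbGroup.0# Y
    exact      : IsSurjective (toKernel j q zero)

record AbSES (Y X : AbGroup ℓ) : Set (lsuc ℓ) where
  constructor mkAbSES
  field
    middle       : AbGroup ℓ
    inclusion    : X →ᴳ middle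
    projection   : middle →ᴳ Y
    isShortExact : IsShortExact inclusion projection

  open IsShortExact isShortExact public

isShortExact-irrelevant : Univalence → {X M Y : AbGroup ℓ} {j : X →ᴳ M} {q : M →ᴳ Y} →
                          Irrelevant (IsShortExact j q)
isShortExact-irrelevant ua {X} {M} {Y} {j} {q} (mkIsShortExact i s z e) (mkIsShortExact i′ s′ z′ e′) =
  go (Πᵢ-irrelevant ua (λ _ → Πᵢ-irrelevant ua λ _ → Π-irrelevant ua λ _ → isSet X) i i′)
     (Π-irrelevant ua (λ _ → ∥∥-irrelevant ua) s s′)
     (Π-irrelevant ua (λ _ → isSet Y) z z′)
     e e′
  where
  go : ∀ {i i′ : Injective _≡_ _≡_ ⟦ j ⟧} {s s′ z z′} →
       _≡_ {A = Injective _≡_ _≡_ ⟦ j ⟧} i i′ → s ≡ s′ → z ≡ z′ → ∀ e e′ →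
       mkIsShortExact {j = j} {q} i s z e ≡ mkIsShortExact i′ s′ z′ e′
  go {i} {s = s} {z = z} refl refl refl e e′ =
    cong (mkIsShortExact i s z) (Π-irrelevant ua (λ _ → ∥∥-irrelevant ua) e e′)

idToMap : {Y X : AbGroup ℓ} {S S′ : AbSES Y X} → S ≡ S′ →
          Carrier (AbSES.middle S) → Carrier (AbSES.middle S′)
idToMap refl = id

-- Every isomorphism of extensions is induced by an identification of them.

AbSES-path : Univalence → {Y X : AbGroup ℓ} (S S′ : AbSES Y X) →
             let module S = AbSES S ; module S′ = AbSES S′ in
             (φ : S.middle →ᴳ S′.middle) → IsEquiv ⟦ φ ⟧ →
             (∀ x → ⟦ φ ⟧ (⟦ S.inclusion ⟧ x) ≡ ⟦ S′.inclusion ⟧ x) →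
             (∀ m → ⟦ S′.projection ⟧ (⟦ φ ⟧ m) ≡ ⟦ S.projection ⟧ m) →
             fibre (idToMap {S = S} {S′}) ⟦ φ ⟧
AbSES-path {ℓ} ua {Y} {X} S S′ φ φ-isEquiv =
  equiv-ind ua Goal base ⟦ φ ⟧ φ-isEquiv
    _ _ _ _ _ S′.inclusion S′.projection S′.isShortExact (_→ᴳ_.isHom φ)
  where
  module S′ = AbSES S′
  open AbSES S
  module M = AbGroup middle

  Goal : (B : Set ℓ) → (Carrier middle → B) → Set (lsuc ℓ)
  Goal B f = ∀ _+_ 0# -_ (set : UIP B) laws → let M′ = mkAbGroup B _+_ 0# -_ set laws in
    (j′ : X →ᴳ M′) (q′ : M′ →ᴳ Y) (se′ : IsShortExact j′ q′) →
    IsGroupHomomorphism M.rawGroup (AbGroup.rawGroup M′) f →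
    (∀ x → f (⟦ inclusion ⟧ x) ≡ ⟦ j′ ⟧ x) → (∀ m → ⟦ q′ ⟧ (f m) ≡ ⟦ projection ⟧ m) →
    fibre (idToMap {S = S} {mkAbSES M′ j′ q′ se′}) f

  sameHoms : ∀ {h h′} se′ → _→ᴳ_.isHom inclusion ≡ h → _→ᴳ_.isHom projection ≡ h′ →
             fibre (idToMap {S = S} {mkAbSES middle (mkHom _ h) (mkHom _ h′) se′}) id
  sameHoms se′ refl refl = same (isShortExact-irrelevant ua isShortExact se′)
    where
    same : ∀ {se} → isShortExact ≡ se →
           fibre (idToMap {S = S} {mkAbSES middle inclusion projection se}) id
    same refl = refl , refl

  sameMiddle : ∀ {j′ q′} (se′ : IsShortExact j′ q′) →
               ⟦ inclusion ⟧ ≡ ⟦ j′ ⟧ → ⟦ projection ⟧ ≡ ⟦ q′ ⟧ →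
               fibre (idToMap {S = S} {mkAbSES middle j′ q′ se′}) id
  sameMiddle {mkHom _ h} {mkHom _ h′} se′ refl refl =
    sameHoms se′ (isHom-irrelevant ua X middle _ h) (isHom-irrelevant ua middle Y _ h′)

  sameLaws : ∀ {set : UIP M.Carrier} {laws} →
             _≡_ {A = UIP M.Carrier} M.isSet set → M.isAbelianGroup ≡ laws →
             let M′ = mkAbGroup M.Carrier M._+_ M.0# M.-_ set laws in
             (j′ : X →ᴳ M′) (q′ : M′ →ᴳ Y) (se′ : IsShortExact j′ q′) →
             ⟦ inclusion ⟧ ≡ ⟦ j′ ⟧ → ⟦ projection ⟧ ≡ ⟦ q′ ⟧ →
             fibre (idToMap {S = S} {mkAbSES M′ j′ q′ se′}) id
  sameLaws refl refl _ _ = sameMiddle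

  sameOperations : ∀ {_+_ 0# -_} (set : UIP M.Carrier) laws →
                   M._+_ ≡ _+_ → M.0# ≡ 0# → M.-_ ≡ -_ →
                   let M′ = mkAbGroup M.Carrier _+_ 0# -_ set laws in
                   (j′ : X →ᴳ M′) (q′ : M′ →ᴳ Y) (se′ : IsShortExact j′ q′) →
                   ⟦ inclusion ⟧ ≡ ⟦ j′ ⟧ → ⟦ projection ⟧ ≡ ⟦ q′ ⟧ →
                   fibre (idToMap {S = S} {mkAbSES M′ j′ q′ se′}) id
  sameOperations set laws refl refl refl =
    sameLaws (UIP-irrelevant ua M.isSet set)
      (isAbelianGroup-irrelevant ua M.isSet M.isAbelianGroup laws)

  base : Goal (Carrier middle) id
  base _ _ _ set laws j′ q′ se′ h j≗j′ q′≗q =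
    sameOperations set laws (ext λ x → ext λ y → h.homo x y) h.ε-homo (ext h.⁻¹-homo)
      j′ q′ se′ (ext j≗j′) (ext λ m → sym (q′≗q m))
    where
    module h = IsGroupHomomorphism h
    ext = extensionality ua ℓ ℓ

trivial : (Y X : AbGroup ℓ) → AbSES Y X
trivial Y X = record
  { middle = X ⊕ Y
  ; inclusion = mkHom (λ x → x , Y.0#) $ mkIsHom X (X ⊕ Y)
      (λ _ _ → cong (_ ,_) (sym (Y.identityˡ _))) refl (λ _ → cong (_ ,_) (sym (ε⁻¹≈ε Y.group)))
  ; projection = mkHom proj₂ (mkIsHom (X ⊕ Y) Y (λ _ _ → refl) refl (λ _ → refl))
  ; isShortExact = record
    { injective = cong proj₁
    ; surjective = λ y P _ h → h ((X.0# , y) , refl)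
    ; zero = λ _ → refl
    ; exact = λ { ((x , _) , e) P _ h → h (x , Σ-≡-irrelevant (λ _ → Y.isSet) (cong (x ,_) (sym e))) }
    }
  }
  where
  module X = AbGroup X
  module Y = AbGroup Y

pullback : {Y Y′ X : AbGroup ℓ} → Y′ →ᴳ Y → AbSES Y X → AbSES Y′ X
pullback {Y = Y} {Y′} {X} g S = record
  { middle = P
  ; inclusion = mkHom (λ x → (⟦ inclusion ⟧ x , Y′.0#) , trans (zero x) (sym g.ε-homo)) $ mkIsHom X P
      (λ _ _ → equal (cong₂ _,_ (j.homo _ _) (sym (Y′.identityˡ _))))
      (equal (cong (_, _) j.ε-homo))
      (λ _ → equal (cong₂ _,_ (j.⁻¹-homo _) (sym (ε⁻¹≈ε Y′.group))))
  ; projection = mkHom (λ { ((_ , y′) , _) → y′ }) (mkIsHom P Y′ (λ _ _ → refl) refl (λ _ → refl))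
  ; isShortExact = record
    { injective = λ e → injective (cong (proj₁ ∘ proj₁) e)
    ; surjective = λ y′ → ∥∥-map (λ { (m , e) → ((m , y′) , e) , refl }) (surjective (⟦ g ⟧ y′))
    ; zero = λ _ → refl
    ; exact = λ { (((m , y′) , e) , y′≡0) →
        ∥∥-map (λ { (x , jx≡m) → x , Σ-≡-irrelevant (λ _ → Y′.isSet)
                     (equal (cong₂ _,_ (cong proj₁ jx≡m) (sym y′≡0))) })
               (exact (m , trans e (trans (cong ⟦ g ⟧ y′≡0) g.ε-homo))) }
    }
  }
  where
  open AbSES S
  module j = _→ᴳ_ inclusion
  module g = _→ᴳ_ g
  module Y′ = AbGroup Y′

  P = fibreProduct projection g

  equal : {x y : Carrier P} → proj₁ x ≡ proj₁ y → x ≡ y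
  equal = Σ-≡-irrelevant (λ _ → isSet Y)

-- The identification is the one induced by ((x , y) , y′) ↦ (x , y′).

pullback-trivial : Univalence → {Y Y′ X : AbGroup ℓ} (g : Y′ →ᴳ Y) →
                   pullback g (trivial Y X) ≡ trivial Y′ X
pullback-trivial ua {Y} {Y′} {X} g = proj₁ $
  AbSES-path ua (pullback g (trivial Y X)) (trivial Y′ X)
    (mkHom to (mkIsHom P (X ⊕ Y′) (λ _ _ → refl) refl (λ _ → refl)))
    (inverse⇒isEquiv (isSet (X ⊕ Y′)) to from (λ _ → refl)
      (λ { (((x , _) , y′) , e) → Σ-≡-irrelevant (λ _ → isSet Y) (cong (λ y → (x , y) , y′) (sym e)) }))
    (λ _ → refl) (λ _ → refl)
  where
  P = fibreProduct (AbSES.projection (trivial Y X)) g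

  to : Carrier P → Carrier (X ⊕ Y′)
  to (((x , _) , y′) , _) = x , y′

  from : Carrier (X ⊕ Y′) → Carrier P
  from (x , y′) = ((x , ⟦ g ⟧ y′) , y′) , refl

------------------------------------------------------------------------
-- Fibre sequences

record Pointed ℓ : Set (lsuc ℓ) where
  constructor _,∙_
  field
    Type : Set ℓ
    pt   : Type

open Pointed

record _→∙_ (A : Pointed a) (B : Pointed b) : Set (a ⊔ b) where
  constructor _,∙_
  field
    map     : Type A → Type B
    map-pt  : map (pt A) ≡ pt B

open _→∙_

infixr 9 _∘∙_

_∘∙_ : {A : Pointed a} {B : Pointed b} {C : Pointed c} → B →∙ C → A →∙ B → A →∙ C
g ∘∙ f = (map g ∘ map f) ,∙ trans (cong (map g) (map-pt f)) (map-pt g)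

const∙ : {A : Pointed a} {B : Pointed b} → A →∙ B
const∙ {B = B} = (λ _ → pt B) ,∙ refl

_∼∙_ : {A : Pointed a} {B : Pointed b} → A →∙ B → A →∙ B → Set (a ⊔ b)
_∼∙_ {A = A} f g = Σ[ H ∈ (∀ x → map f x ≡ map g x) ] trans (H (pt A)) (map-pt g) ≡ map-pt f

toFibre : {F : Pointed a} {T : Pointed b} {S : Pointed c} (u : F →∙ T) (v : T →∙ S) →
          (v ∘∙ u) ∼∙ const∙ → Type F → fibre (map v) (pt S)
toFibre u v (H , _) x = map u x , H x

-- The induced map depends on the null-homotopy, which is therefore part of the data.

IsFibreSequence : {F : Pointed a} {T : Pointed b} {S : Pointed c} → F →∙ T → T →∙ S → Set (a ⊔ b ⊔ c)
IsFibreSequence u v = Σ[ H ∈ (v ∘∙ u) ∼∙ const∙ ] IsEquiv (toFibre u v H)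

AbSES∙ : (Y X : AbGroup ℓ) → Pointed (lsuc ℓ)
AbSES∙ Y X = AbSES Y X ,∙ trivial Y X

pullback∙ : Univalence → {Y Y′ : AbGroup ℓ} → Y′ →ᴳ Y → (X : AbGroup ℓ) → AbSES∙ Y X →∙ AbSES∙ Y′ X
pullback∙ ua g X = pullback g ,∙ pullback-trivial ua g

{-# OPTIONS --without-K #-}

-- An identification of extensions is the same as an additive map commuting with the inclusions
-- and the projections, so every equation between identifications is checked on elements.
-- Given α : i*F ≡ 0, the middle group of i*F is the kernel of F → E → B, and the first component
-- of α retracts it onto G; pushing out along this retraction divides F by the copy of A in it and
-- yields an extension of B by G.  This is inverse to the map induced by p*: an extension
-- F of E by G with a compatible map to S is p*S, and S is the quotient of p*S by A.

module Submission where

open import Algebra.Bundles using (module AbelianGroup)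
open import Algebra.Properties.AbelianGroup using (⁻¹-∙-comm)
open import Algebra.Properties.CommutativeSemigroup using (interchange)
open import Algebra.Properties.Group
  using (∙-cancelʳ; identityʳ-unique; inverseˡ-unique; //-rightDividesˡ; ε⁻¹≈ε; x∙y⁻¹≈ε⇒x≈y)
open import Algebra.Structures using (IsAbelianGroup)
open import Axiom.UniquenessOfIdentityProofs using (UIP; module Constant⇒UIP)
open import Data.Product.Base using (Σ; Σ-syntax; _×_; _,_; proj₁; proj₂)
open import Data.Product.Properties using (Σ-≡,≡→≡; Σ-≡,≡←≡)
open import Function.Base using (id; _∘_)
open import Function.Bundles using (mk↔ₛ′)
open import Function.Definitions using (Injective)
import Function.Properties.Inverse.HalfAdjointEquivalence as HalfAdjoint
open import Level using (Level)
open import Relation.Binary.PropositionalEquality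
  using (_≡_; refl; sym; trans; cong; cong₂; cong-app; subst; trans-reflʳ; trans-injectiveʳ;
         module ≡-Reasoning)
open import Relation.Nullary.Irrelevant using (Irrelevant)
open import Defs

open AbGroup using (Carrier; isSet)
open _→ᴳ_ using (⟦_⟧)
open AbSES using (middle; inclusion; projection)
open ≡-Reasoning

private
  variable
    a b c ℓ : Level

-- Equivalences, sets and unique choice

fibre-≡ : {A : Set a} {B : Set b} {f : A → B} {y : B} {x x′ : A} {e : f x ≡ y} {e′ : f x′ ≡ y}
          (β : x ≡ x′) → trans (cong f β) e′ ≡ e → _≡_ {A = fibre f y} (x , e) (x′ , e′)
fibre-≡ refl refl = refl

-- Types of extensions need not be sets, so the two homotopies are first made coherent: the triangle
-- identity of a half adjoint equivalence contracts each fibre.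
quasiInverse⇒isEquiv : {A : Set a} {B : Set b} (f : A → B) (g : B → A) →
                       (∀ y → f (g y) ≡ y) → (∀ x → g (f x) ≡ x) → IsEquiv f
quasiInverse⇒isEquiv f g fg gf y =
  (g y , right-inverse-of y) ,
  λ { (x , refl) → fibre-≡ (left-inverse-of x) (trans (trans-reflʳ _) (left-right x)) }
  where open HalfAdjoint._≃_ (HalfAdjoint.↔⇒≃ (mk↔ₛ′ f g fg gf))

injective⇒fibre-irrelevant : {A : Set a} {B : Set b} → UIP B → {f : A → B} →
                             Injective _≡_ _≡_ f → ∀ y → Irrelevant (fibre f y)
injective⇒fibre-irrelevant uB inj y (_ , e) (_ , e′) =
  Σ-≡-irrelevant (λ _ → uB) (inj (trans e (sym e′)))

-- Injectivity into a set makes each fibre a proposition, so the truncated preimage can be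
-- eliminated into the fibre itself.
bijective⇒isEquiv : {A B : Set ℓ} → UIP B → {f : A → B} →
                    Injective _≡_ _≡_ f → IsSurjective f → IsEquiv f
bijective⇒isEquiv uB inj surj y = centre , injective⇒fibre-irrelevant uB inj y centre
  where centre = surj y _ (injective⇒fibre-irrelevant uB inj y) id

-- A retract of the identity types based at a point, fibrewise over the other endpoint, is
-- equivalent to them: p ↦ d (e p) is idempotent, and equals p ↦ trans (d (e refl)) p.

section⇒retraction : {A : Set a} {R : A → Set b} {x : A}
                     (e : ∀ {y} → x ≡ y → R y) (d : ∀ {y} → R y → x ≡ y) →
                     (∀ {y} (r : R y) → e (d r) ≡ r) → ∀ {y} (p : x ≡ y) → d (e p) ≡ p
section⇒retraction e d ed refl =
  trans-injectiveʳ (d (e refl)) (begin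
    trans (d (e refl)) (d (e refl)) ≡⟨ sym (translation (d (e refl))) ⟩
    d (e (d (e refl)))              ≡⟨ cong d (ed (e refl)) ⟩
    d (e refl)                      ≡⟨ sym (trans-reflʳ _) ⟩
    trans (d (e refl)) refl         ∎)
  where
  translation : ∀ {y} (p : _ ≡ y) → d (e p) ≡ trans (d (e refl)) p
  translation refl = sym (trans-reflʳ _)

-- A path in `Σ A B` can be rebuilt from its pair of components, and the type of such pairs is a
-- proposition; the rebuilding is thus a constant endomap of the identity type.
Σ-UIP-fibrewise : {A : Set a} {B : A → Set b} → UIP A → (∀ x → UIP (B x)) → UIP (Σ A B)
Σ-UIP-fibrewise {B = B} uA uB = Constant⇒UIP.≡-irrelevant
  (λ p → Σ-≡,≡→≡ (Σ-≡,≡←≡ p))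
  (λ p q → cong Σ-≡,≡→≡ (unique (Σ-≡,≡←≡ p) (Σ-≡,≡←≡ q)))
  where
  unique : ∀ {x x′} {y : B x} {y′ : B x′} → Irrelevant (Σ (x ≡ x′) λ p → subst B p y ≡ y′)
  unique (p , h) (p′ , h′) = Σ-≡-irrelevant (λ _ → uB _) (uA p p′)

Π-UIP : Univalence → {A : Set a} {B : A → Set b} → (∀ x → UIP (B x)) → UIP (∀ x → B x)
Π-UIP ua uB = Constant⇒UIP.≡-irrelevant
  (λ p → ext (cong-app p))
  (λ p q → cong ext (ext λ x → uB x (cong-app p x) (cong-app q x)))
  where
  ext : ∀ {a b} {A : Set a} {B : A → Set b} {f g : ∀ x → B x} → (∀ x → f x ≡ g x) → f ≡ g
  ext = extensionality ua _ _

surjective-elim : {A C : Set ℓ} {π : A → C} → IsSurjective π → {P : C → Set ℓ} →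
                  (∀ c → Irrelevant (P c)) → (∀ x → P (π x)) → ∀ c → P c
surjective-elim surj irr f c = surj c _ (irr c) λ { (x , refl) → f x }

×-surjective : {A B C D : Set ℓ} {f : A → C} {g : B → D} → IsSurjective f → IsSurjective g →
               IsSurjective {A = A × B} {B = C × D} (λ z → f (proj₁ z) , g (proj₂ z))
×-surjective f-surj g-surj (c , d) P irr k =
  f-surj c P irr λ { (x , p) → g-surj d P irr λ { (y , q) → k ((x , y) , cong₂ _,_ p q) } }

-- The value at c is characterised uniquely, so it can be extracted from the truncation.

descend : Univalence → {A C D : Set ℓ} {π : A → C} → IsSurjective π → UIP D → (f : A → D) →
          (∀ x y → π x ≡ π y → f x ≡ f y) → Σ[ g ∈ (C → D) ] (∀ x → g (π x) ≡ f x)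
descend {ℓ} ua {A} {C} {D} {π} surj uD f resp =
  (λ c → proj₁ (value c)) , λ x → sym (proj₂ (value (π x)) x refl)
  where
  Value : C → Set ℓ
  Value c = Σ[ d ∈ D ] (∀ x → π x ≡ c → f x ≡ d)

  value-irrelevant : ∀ c → Irrelevant (Value c)
  value-irrelevant c (d , h) (d′ , h′) =
    Σ-≡-irrelevant (λ _ → Π-irrelevant ua λ _ → Π-irrelevant ua λ _ → uD)
      (surj c (d ≡ d′) uD λ { (x , e) → trans (sym (h x e)) (h′ x e) })

  value : ∀ c → Value c
  value = surjective-elim surj value-irrelevant (λ x → f x , λ y e → resp y x e)

descend₂ : Univalence → {A C D : Set ℓ} {π : A → C} → IsSurjective π → UIP D → (f : A → A → D) →
           (∀ x x′ y y′ → π x ≡ π x′ → π y ≡ π y′ → f x y ≡ f x′ y′) →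
           Σ[ g ∈ (C → C → D) ] (∀ x y → g (π x) (π y) ≡ f x y)
descend₂ ua {A} {C} {D} {π} surj uD f resp = (λ c d → proj₁ g (c , d)) , λ x y → proj₂ g (x , y)
  where
  g : Σ[ g ∈ (C × C → D) ] (∀ z → g (π (proj₁ z) , π (proj₂ z)) ≡ f (proj₁ z) (proj₂ z))
  g = descend ua (×-surjective surj surj) uD (λ z → f (proj₁ z) (proj₂ z))
        (λ _ _ e → resp _ _ _ _ (cong proj₁ e) (cong proj₂ e))

-- Additive maps and short exact sequences

Additive : (X Y : AbGroup ℓ) → (Carrier X → Carrier Y) → Set ℓ
Additive X Y f = ∀ x y → f (x X.+ y) ≡ f x Y.+ f y
  where module X = AbGroup X
        module Y = AbGroup Y

additive⇒hom : (X Y : AbGroup ℓ) (f : Carrier X → Carrier Y) → Additive X Y f → X →ᴳ Y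
additive⇒hom X Y f add = mkHom f (mkIsHom X Y add f0 λ x → inverseˡ-unique Y.group _ _
  (trans (sym (add _ _)) (trans (cong f (X.inverseˡ x)) f0)))
  where
  module X = AbGroup X
  module Y = AbGroup Y
  f0 = identityʳ-unique Y.group (f X.0#) (f X.0#)
         (trans (sym (add _ _)) (cong f (X.identityˡ X.0#)))

hom-injective : {X Y : AbGroup ℓ} (f : X →ᴳ Y) →
                (∀ x → ⟦ f ⟧ x ≡ AbGroup.0# Y → x ≡ AbGroup.0# X) → Injective _≡_ _≡_ ⟦ f ⟧
hom-injective {X = X} {Y} f ker {x} {y} e = x∙y⁻¹≈ε⇒x≈y X.group x y (ker _ (begin
  ⟦ f ⟧ (x X.+ (X.- y))         ≡⟨ f.homo _ _ ⟩
  ⟦ f ⟧ x Y.+ ⟦ f ⟧ (X.- y)     ≡⟨ cong₂ Y._+_ e (f.⁻¹-homo y) ⟩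
  ⟦ f ⟧ y Y.+ (Y.- ⟦ f ⟧ y)     ≡⟨ Y.inverseʳ _ ⟩
  Y.0#                          ∎))
  where
  module X = AbGroup X
  module Y = AbGroup Y
  module f = _→ᴳ_ f

module _ {X M Y : AbGroup ℓ} {j : X →ᴳ M} {q : M →ᴳ Y} (se : IsShortExact j q) where
  private
    module M = AbGroup M
    module Y = AbGroup Y
    module j = _→ᴳ_ j
    module q = _→ᴳ_ q
  open IsShortExact se

  -- Injectivity of `j` makes the preimage unique, so exactness yields it without truncation.
  kernel-lift : ∀ m → ⟦ q ⟧ m ≡ Y.0# → fibre ⟦ j ⟧ m
  kernel-lift m e = exact (m , e) _ (injective⇒fibre-irrelevant M.isSet injective m)
    λ { (x , h) → x , cong proj₁ h }

  difference : ∀ m m′ → ⟦ q ⟧ m ≡ ⟦ q ⟧ m′ → Σ[ x ∈ Carrier X ] ⟦ j ⟧ x M.+ m′ ≡ m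
  difference m m′ e = proj₁ lift , trans (cong (M._+ m′) (proj₂ lift)) (//-rightDividesˡ M.group m′ m)
    where
    lift = kernel-lift (m M.+ (M.- m′)) (begin
      ⟦ q ⟧ (m M.+ (M.- m′))          ≡⟨ q.homo _ _ ⟩
      ⟦ q ⟧ m Y.+ ⟦ q ⟧ (M.- m′)      ≡⟨ cong₂ Y._+_ e (q.⁻¹-homo m′) ⟩
      ⟦ q ⟧ m′ Y.+ (Y.- ⟦ q ⟧ m′)     ≡⟨ Y.inverseʳ _ ⟩
      Y.0#                            ∎)

  translation-injective : ∀ {x y} m → ⟦ j ⟧ x M.+ m ≡ ⟦ j ⟧ y M.+ m → x ≡ y
  translation-injective m e = injective (∙-cancelʳ M.group m _ _ e)

  projection-translation : ∀ x m → ⟦ q ⟧ (⟦ j ⟧ x M.+ m) ≡ ⟦ q ⟧ m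
  projection-translation x m =
    trans (q.homo _ _) (trans (cong (Y._+ ⟦ q ⟧ m) (zero x)) (Y.identityˡ _))

-- Identifications of extensions

record IsMorphism {Y X : AbGroup ℓ} (S S′ : AbSES Y X)
                  (f : Carrier (middle S) → Carrier (middle S′)) : Set ℓ where
  constructor mkIsMorphism
  field
    additive           : Additive (middle S) (middle S′) f
    commutesInclusion  : ∀ x → f (⟦ inclusion S ⟧ x) ≡ ⟦ inclusion S′ ⟧ x
    commutesProjection : ∀ m → ⟦ projection S′ ⟧ (f m) ≡ ⟦ projection S ⟧ m

open IsMorphism

module _ {Y X : AbGroup ℓ} where

  isMorphism-irrelevant : Univalence → (S S′ : AbSES Y X) → ∀ f → Irrelevant (IsMorphism S S′ f)
  isMorphism-irrelevant ua S S′ f = retract-irrelevant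
    (λ { (a , i , p) → mkIsMorphism a i p }) (λ { (mkIsMorphism a i p) → a , i , p }) (λ _ → refl)
    (×-irrelevant (Π-irrelevant ua λ _ → Π-irrelevant ua λ _ → isSet (middle S′))
      (×-irrelevant (Π-irrelevant ua λ _ → isSet (middle S′)) (Π-irrelevant ua λ _ → isSet Y)))

  -- The short five lemma. An element killed by `f` comes from `X`, where injectivity of the second
  -- inclusion makes it zero.
  morphism-isEquiv : (S S′ : AbSES Y X) → ∀ {f} → IsMorphism S S′ f → IsEquiv f
  morphism-isEquiv S S′ {f} mor =
    bijective⇒isEquiv (isSet (middle S′)) (hom-injective φ kernel-trivial) surj
    where
    module S = AbSES S
    module S′ = AbSES S′
    φ = additive⇒hom S.middle S′.middle f (additive mor)

    kernel-trivial : ∀ m → f m ≡ AbGroup.0# S′.middle → m ≡ AbGroup.0# S.middle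
    kernel-trivial m e with kernel-lift S.isShortExact m
      (trans (sym (commutesProjection mor m))
             (trans (cong ⟦ S′.projection ⟧ e) (_→ᴳ_.ε-homo S′.projection)))
    ... | x , refl = trans (cong ⟦ S.inclusion ⟧ x≡0) (_→ᴳ_.ε-homo S.inclusion)
      where
      x≡0 : x ≡ AbGroup.0# X
      x≡0 = S′.injective (trans (sym (commutesInclusion mor x))
                                (trans e (sym (_→ᴳ_.ε-homo S′.inclusion))))

    surj : IsSurjective f
    surj m′ = ∥∥-map
      -- The chosen `m` has the right image in `Y` only; `f m` misses `m′` by some `x` in `X`, which
      -- is added to `m`.
      (λ { (m , e) → let (x , h) = difference S′.isShortExact m′ (f m)
                                     (trans (sym e) (sym (commutesProjection mor m))) in
           ⟦ S.inclusion ⟧ x M.+ m ,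
           trans (additive mor _ _) (trans (cong (M′._+ f m) (commutesInclusion mor x)) h) })
      (S.surjective (⟦ S′.projection ⟧ m′))
      where
      module M = AbGroup S.middle
      module M′ = AbGroup S′.middle

  idToMap-isMorphism : {S S′ : AbSES Y X} (p : S ≡ S′) → IsMorphism S S′ (idToMap p)
  idToMap-isMorphism refl = mkIsMorphism (λ _ _ → refl) (λ _ → refl) (λ _ → refl)

  idToMap-trans : {S S′ S″ : AbSES Y X} (p : S ≡ S′) (p′ : S′ ≡ S″) →
                  ∀ m → idToMap (trans p p′) m ≡ idToMap p′ (idToMap p m)
  idToMap-trans refl refl _ = refl

  idToMap-cong-pullback : {Y′ : AbGroup ℓ} (g : Y′ →ᴳ Y) {S S′ : AbSES Y X} (p : S ≡ S′) →
    ∀ n → proj₁ (idToMap (cong (pullback g) p) n) ≡ (idToMap p (proj₁ (proj₁ n)) , proj₂ (proj₁ n))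
  idToMap-cong-pullback g refl _ = refl

  module _ (ua : Univalence) where

    opaque
      -- Opaque, so that paths obtained from univalence are handled only through their action on
      -- elements.
      morphism⇒fibre : (S S′ : AbSES Y X) → ∀ {f} → IsMorphism S S′ f →
                       fibre (idToMap {S = S} {S′}) f
      morphism⇒fibre S S′ {f} mor =
        AbSES-path ua S S′ (additive⇒hom (middle S) (middle S′) f (additive mor))
          (morphism-isEquiv S S′ mor) (commutesInclusion mor) (commutesProjection mor)

    -- Encode-decode: every morphism is realised by a path, so morphisms are a retract of the
    -- identity types based at `S`, and `section⇒retraction` makes encoding injective.
    idToMap-injective : {S S′ : AbSES Y X} {p p′ : S ≡ S′} →
                        (∀ m → idToMap p m ≡ idToMap p′ m) → p ≡ p′
    idToMap-injective {S} {S′} {p} {p′} e = begin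
      p                     ≡⟨ sym (decode-encode p) ⟩
      decode (encode p)     ≡⟨ cong decode (Σ-≡-irrelevant (isMorphism-irrelevant ua S S′)
                                              (extensionality ua _ _ e)) ⟩
      decode (encode p′)    ≡⟨ decode-encode p′ ⟩
      p′                    ∎
      where
      Morphism : AbSES Y X → Set _
      Morphism T = Σ _ (IsMorphism S T)

      encode : ∀ {T} → S ≡ T → Morphism T
      encode p = idToMap p , idToMap-isMorphism p

      decode : ∀ {T} → Morphism T → S ≡ T
      decode (_ , mor) = proj₁ (morphism⇒fibre S _ mor)

      decode-encode : ∀ {T} (p : S ≡ T) → decode (encode p) ≡ p
      decode-encode = section⇒retraction encode decode λ { (_ , mor) →
        Σ-≡-irrelevant (isMorphism-irrelevant ua S _) (proj₂ (morphism⇒fibre S _ mor)) }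

  -- pullback-trivial is by definition the first component of the fibre given by AbSES-path.

  idToMap-pullback-trivial : (ua : Univalence) {Y′ : AbGroup ℓ} (g : Y′ →ᴳ Y) → ∀ n →
    idToMap (pullback-trivial ua {X = X} g) n ≡ (proj₁ (proj₁ (proj₁ n)) , proj₂ (proj₁ n))
  idToMap-pullback-trivial ua g = cong-app (proj₂ (AbSES-path ua _ _ _ _ _ _))

module _ (ua : Univalence) {Y Y′ X : AbGroup ℓ} (g : Y′ →ᴳ Y) where

  -- The universal property of the fibre product turns `f` into a morphism of extensions from `F` to
  -- `pullback g T`, and every such morphism comes from a path.
  pullback-unique : (F : AbSES Y′ X) (T : AbSES Y X) (f : middle F →ᴳ middle T) →
    (∀ x → ⟦ f ⟧ (⟦ inclusion F ⟧ x) ≡ ⟦ inclusion T ⟧ x) →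
    (∀ m → ⟦ projection T ⟧ (⟦ f ⟧ m) ≡ ⟦ g ⟧ (⟦ projection F ⟧ m)) →
    Σ[ β ∈ F ≡ pullback g T ] (∀ m → proj₁ (proj₁ (idToMap β m)) ≡ ⟦ f ⟧ m)
  pullback-unique F T f f-inclusion f-projection =
    proj₁ w , λ m → cong (proj₁ ∘ proj₁) (cong-app (proj₂ w) m)
    where
    f′ : Carrier (middle F) → Carrier (middle (pullback g T))
    f′ m = (⟦ f ⟧ m , ⟦ projection F ⟧ m) , f-projection m

    w = morphism⇒fibre ua F (pullback g T) {f′} (mkIsMorphism
      (λ m m′ → Σ-≡-irrelevant (λ _ → isSet Y)
        (cong₂ _,_ (_→ᴳ_.homo f m m′) (_→ᴳ_.homo (projection F) m m′)))
      (λ x → Σ-≡-irrelevant (λ _ → isSet Y) (cong₂ _,_ (f-inclusion x) (AbSES.zero F x)))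
      (λ _ → refl))

-- Pushout of an extension along a surjection

module Pushout (ua : Univalence) {N M B G : AbGroup ℓ} {ι : N →ᴳ M} {ρ : M →ᴳ B}
               (se : IsShortExact ι ρ) (r : N →ᴳ G) (r-surjective : IsSurjective ⟦ r ⟧) where
  private
    module N = AbGroup N
    module M = AbGroup M
    module B = AbGroup B
    module G = AbGroup G
    module ι = _→ᴳ_ ι
    module ρ = _→ᴳ_ ρ
    module r = _→ᴳ_ r
    module se = IsShortExact se

  -- There are no quotient types, and classes given by predicates would raise the universe level.
  -- Instead the class of m modulo the kernel of r is encoded by its image in B together with the
  -- function on the fibre over this image that sends m′ to r n, where ι n + m′ = m.

  IsEquivariant : ∀ {b} → (∀ m → ⟦ ρ ⟧ m ≡ b → G.Carrier) → Set ℓ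
  IsEquivariant t = ∀ n m e e′ → ⟦ r ⟧ n G.+ t (⟦ ι ⟧ n M.+ m) e ≡ t m e′

  equivariant-irrelevant : ∀ {b} (t : ∀ m → ⟦ ρ ⟧ m ≡ b → G.Carrier) → Irrelevant (IsEquivariant t)
  equivariant-irrelevant _ =
    Π-irrelevant ua λ _ → Π-irrelevant ua λ _ → Π-irrelevant ua λ _ → Π-irrelevant ua λ _ → G.isSet

  Quotient : Set ℓ
  Quotient = Σ[ b ∈ B.Carrier ] Σ[ t ∈ (∀ m → ⟦ ρ ⟧ m ≡ b → G.Carrier) ] IsEquivariant t

  opaque
    Quotient-UIP : UIP Quotient
    Quotient-UIP = Σ-UIP-fibrewise B.isSet λ _ →
      Σ-UIP (Π-UIP ua λ _ → Π-UIP ua λ _ → G.isSet) equivariant-irrelevant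

  Quotient-≡ : {c c′ : Quotient} → proj₁ c ≡ proj₁ c′ →
               (∀ m e e′ → proj₁ (proj₂ c) m e ≡ proj₁ (proj₂ c′) m e′) → c ≡ c′
  Quotient-≡ {b , _} refl h = cong (b ,_) (Σ-≡-irrelevant equivariant-irrelevant
    (extensionality ua _ _ λ m → extensionality ua _ _ λ e → h m e e))

  Quotient-≡⁻¹ : {c c′ : Quotient} → c ≡ c′ →
                 ∀ m e e′ → proj₁ (proj₂ c) m e ≡ proj₁ (proj₂ c′) m e′
  Quotient-≡⁻¹ {c} refl m e e′ = cong (proj₁ (proj₂ c) m) (B.isSet e e′)

  -- Classes of elements and the relation they encode

  minus : ∀ m m′ → ⟦ ρ ⟧ m′ ≡ ⟦ ρ ⟧ m → N.Carrier
  minus m m′ e = proj₁ (difference se m m′ (sym e))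

  minus-unique : ∀ {n} m m′ e → ⟦ ι ⟧ n M.+ m′ ≡ m → minus m m′ e ≡ n
  minus-unique m m′ e h =
    translation-injective se m′ (trans (proj₂ (difference se m m′ (sym e))) (sym h))

  -- Congruence modulo the image under `ι` of the kernel of `r`.
  _∼_ : M.Carrier → M.Carrier → Set ℓ
  m ∼ m′ = Σ[ n ∈ N.Carrier ] (⟦ ι ⟧ n M.+ m′ ≡ m) × (⟦ r ⟧ n ≡ G.0#)

  opaque
    minus-equivariant : ∀ m → IsEquivariant (λ m′ e → ⟦ r ⟧ (minus m m′ e))
    minus-equivariant m n m′ e e′ =
      trans (sym (r.homo _ _)) (cong ⟦ r ⟧ (sym (minus-unique m m′ e′ (begin
        ⟦ ι ⟧ (n N.+ d) M.+ m′            ≡⟨ cong (λ n → ⟦ ι ⟧ n M.+ m′) (N.comm n d) ⟩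
        ⟦ ι ⟧ (d N.+ n) M.+ m′            ≡⟨ cong (M._+ m′) (ι.homo d n) ⟩
        ⟦ ι ⟧ d M.+ ⟦ ι ⟧ n M.+ m′        ≡⟨ M.assoc _ _ _ ⟩
        ⟦ ι ⟧ d M.+ (⟦ ι ⟧ n M.+ m′)      ≡⟨ proj₂ (difference se m (⟦ ι ⟧ n M.+ m′) (sym e)) ⟩
        m                                 ∎))))
      where
      d : N.Carrier
      d = minus m (⟦ ι ⟧ n M.+ m′) e

    [_] : M.Carrier → Quotient
    [ m ] = ⟦ ρ ⟧ m , (λ m′ e → ⟦ r ⟧ (minus m m′ e)) , minus-equivariant m

    -- Recorded as an equation because `[_]` does not unfold outside this opaque block.
    image-[] : ∀ m → proj₁ [ m ] ≡ ⟦ ρ ⟧ m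
    image-[] _ = refl

    ∼⇒≡ : ∀ {m m′} → m ∼ m′ → [ m ] ≡ [ m′ ]
    ∼⇒≡ {m} {m′} (n , refl , rn≡0) = Quotient-≡ (projection-translation se n m′) λ x e e′ → begin
      ⟦ r ⟧ (minus (⟦ ι ⟧ n M.+ m′) x e)   ≡⟨ cong ⟦ r ⟧ (minus-unique (⟦ ι ⟧ n M.+ m′) x e (begin
        ⟦ ι ⟧ (n N.+ minus m′ x e′) M.+ x          ≡⟨ cong (M._+ x) (ι.homo _ _) ⟩
        ⟦ ι ⟧ n M.+ ⟦ ι ⟧ (minus m′ x e′) M.+ x    ≡⟨ M.assoc _ _ _ ⟩
        ⟦ ι ⟧ n M.+ (⟦ ι ⟧ (minus m′ x e′) M.+ x)
          ≡⟨ cong (⟦ ι ⟧ n M.+_) (proj₂ (difference se m′ x (sym e′))) ⟩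
        ⟦ ι ⟧ n M.+ m′                             ∎)) ⟩
      ⟦ r ⟧ (n N.+ minus m′ x e′)          ≡⟨ r.homo _ _ ⟩
      ⟦ r ⟧ n G.+ ⟦ r ⟧ (minus m′ x e′)    ≡⟨ cong (G._+ ⟦ r ⟧ (minus m′ x e′)) rn≡0 ⟩
      G.0# G.+ ⟦ r ⟧ (minus m′ x e′)       ≡⟨ G.identityˡ _ ⟩
      ⟦ r ⟧ (minus m′ x e′)                ∎

    -- Both functions are evaluated at `m′`: that of `m` gives `r` of the difference, that of `m′`
    -- gives zero.
    ≡⇒∼ : ∀ {m m′} → [ m ] ≡ [ m′ ] → m ∼ m′
    ≡⇒∼ {m} {m′} e = minus m m′ ρe , proj₂ (difference se m m′ (sym ρe)) , (begin
      ⟦ r ⟧ (minus m m′ ρe)     ≡⟨ Quotient-≡⁻¹ e m′ ρe refl ⟩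
      ⟦ r ⟧ (minus m′ m′ refl)  ≡⟨ cong ⟦ r ⟧ (minus-unique m′ m′ refl
                                     (trans (cong (M._+ m′) ι.ε-homo) (M.identityˡ m′))) ⟩
      ⟦ r ⟧ N.0#                ≡⟨ r.ε-homo ⟩
      G.0#                      ∎)
      where
      ρe : ⟦ ρ ⟧ m′ ≡ ⟦ ρ ⟧ m
      ρe = sym (cong proj₁ e)

    -- A representative is a point of the fibre over `b` where `t` vanishes. Starting from any `m`
    -- there, translating by `n` with `⟦ r ⟧ n` equal to `t m h` gives one by equivariance.
    []-surjective : IsSurjective [_]
    []-surjective (b , t , equivariant) P irr k =
      se.surjective b P irr λ { (m , h) → r-surjective (t m h) P irr λ { (n , rn≡t) →
      let m₀ = ⟦ ι ⟧ n M.+ m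
          h₀ = trans (projection-translation se n m) h
          t≡0 : t m₀ h₀ ≡ G.0#
          t≡0 = identityʳ-unique G.group (⟦ r ⟧ n) _ (trans (equivariant n m h₀ h) (sym rn≡t))
      in k (m₀ , Quotient-≡ h₀ λ x e e′ →
        let (d , hd) = difference se m₀ x (sym e)
            h₁ = trans (cong ⟦ ρ ⟧ hd) h₀
        in begin
          -- Since `m₀` is the translate of `x` by `d`, the zero of `t` at `m₀` determines its value
          -- at `x`.
          ⟦ r ⟧ d                                ≡⟨ sym (G.identityʳ _) ⟩
          ⟦ r ⟧ d G.+ G.0#                       ≡⟨ cong (⟦ r ⟧ d G.+_) (sym t≡0) ⟩
          ⟦ r ⟧ d G.+ t m₀ h₀                    ≡⟨ cong (⟦ r ⟧ d G.+_) (cong-fibre t (sym hd) h₀ h₁) ⟩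
          ⟦ r ⟧ d G.+ t (⟦ ι ⟧ d M.+ x) h₁       ≡⟨ equivariant d x h₁ e′ ⟩
          t x e′                                 ∎) } }
      where
      cong-fibre : ∀ {b} (t : ∀ m → ⟦ ρ ⟧ m ≡ b → G.Carrier) {m m′} → m ≡ m′ →
                   ∀ e e′ → t m e ≡ t m′ e′
      cong-fibre t {m} refl e e′ = cong (t m) (B.isSet e e′)

  ∼-+ : ∀ {m₁ m₁′ m₂ m₂′} → m₁ ∼ m₁′ → m₂ ∼ m₂′ → (m₁ M.+ m₂) ∼ (m₁′ M.+ m₂′)
  ∼-+ (n₁ , e₁ , z₁) (n₂ , e₂ , z₂) = (n₁ N.+ n₂) ,
    trans (cong (M._+ _) (ι.homo _ _))
          (trans (interchange (AbelianGroup.commutativeSemigroup M.abelianGroup) _ _ _ _)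
                 (cong₂ M._+_ e₁ e₂)) ,
    trans (r.homo _ _) (trans (cong₂ G._+_ z₁ z₂) (G.identityˡ _))

  ∼-- : ∀ {m m′} → m ∼ m′ → (M.- m) ∼ (M.- m′)
  ∼-- (n , e , z) = (N.- n) ,
    trans (cong (M._+ _) (ι.⁻¹-homo _)) (trans (⁻¹-∙-comm M.abelianGroup _ _) (cong M.-_ e)) ,
    trans (r.⁻¹-homo _) (trans (cong G.-_ z) (ε⁻¹≈ε G.group))

  -- The group structure on the quotient

  opaque
    sum : Σ[ s ∈ (Quotient → Quotient → Quotient) ] (∀ m m′ → s [ m ] [ m′ ] ≡ [ m M.+ m′ ])
    sum = descend₂ ua []-surjective Quotient-UIP (λ m m′ → [ m M.+ m′ ])
      (λ _ _ _ _ e e′ → ∼⇒≡ (∼-+ (≡⇒∼ e) (≡⇒∼ e′)))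

    negative : Σ[ s ∈ (Quotient → Quotient) ] (∀ m → s [ m ] ≡ [ M.- m ])
    negative = descend ua []-surjective Quotient-UIP (λ m → [ M.- m ]) (λ _ _ → ∼⇒≡ ∘ ∼-- ∘ ≡⇒∼)

  infixl 6 _⊞_

  _⊞_ : Quotient → Quotient → Quotient
  _⊞_ = proj₁ sum

  []-+ : ∀ m m′ → [ m ] ⊞ [ m′ ] ≡ [ m M.+ m′ ]
  []-+ = proj₂ sum

  elim : {P : Quotient → Set ℓ} → (∀ c → Irrelevant (P c)) → (∀ m → P [ m ]) → ∀ c → P c
  elim = surjective-elim []-surjective

  opaque
    ⊞-isAbelianGroup : IsAbelianGroup _≡_ _⊞_ [ M.0# ] (proj₁ negative)
    ⊞-isAbelianGroup = mkIsAbelianGroup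
      (elim (λ _ → Π-irrelevant ua λ _ → Π-irrelevant ua λ _ → Quotient-UIP) λ x →
       elim (λ _ → Π-irrelevant ua λ _ → Quotient-UIP) λ y →
       elim (λ _ → Quotient-UIP) λ z → begin
         [ x ] ⊞ [ y ] ⊞ [ z ]      ≡⟨ cong (_⊞ [ z ]) ([]-+ x y) ⟩
         [ x M.+ y ] ⊞ [ z ]        ≡⟨ []-+ _ z ⟩
         [ x M.+ y M.+ z ]          ≡⟨ cong [_] (M.assoc x y z) ⟩
         [ x M.+ (y M.+ z) ]        ≡⟨ sym ([]-+ x _) ⟩
         [ x ] ⊞ [ y M.+ z ]        ≡⟨ cong ([ x ] ⊞_) (sym ([]-+ y z)) ⟩
         [ x ] ⊞ ([ y ] ⊞ [ z ])    ∎)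
      (elim (λ _ → Quotient-UIP) λ x → trans ([]-+ _ x) (cong [_] (M.identityˡ x)))
      (elim (λ _ → Quotient-UIP) λ x →
        trans (cong (_⊞ [ x ]) (proj₂ negative x)) (trans ([]-+ _ x) (cong [_] (M.inverseˡ x))))
      (elim (λ _ → Π-irrelevant ua λ _ → Quotient-UIP) λ x → elim (λ _ → Quotient-UIP) λ y →
        trans ([]-+ x y) (trans (cong [_] (M.comm x y)) (sym ([]-+ y x))))

  quotient : AbGroup ℓ
  quotient = record
    { Carrier = Quotient
    ; _+_ = _⊞_
    ; 0# = [ M.0# ]
    ; -_ = proj₁ negative
    ; isSet = Quotient-UIP
    ; isAbelianGroup = ⊞-isAbelianGroup
    }

  -- The quotient as an extension of `B` by `G`, and its universal property

  opaque
    -- An element of `G` is lifted along `r` and then sent to `M`; two lifts differ by an element of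
    -- the kernel of `r`, so the class is independent of the choice.
    embed : Σ[ f ∈ (G.Carrier → Quotient) ] (∀ n → f (⟦ r ⟧ n) ≡ [ ⟦ ι ⟧ n ])
    embed = descend ua r-surjective Quotient-UIP (λ n → [ ⟦ ι ⟧ n ]) λ n n′ e → ∼⇒≡
      ( (n N.+ (N.- n′))
      , trans (cong (M._+ ⟦ ι ⟧ n′) (trans (ι.homo _ _) (cong (_ M.+_) (ι.⁻¹-homo n′))))
              (//-rightDividesˡ M.group _ _)
      , trans (r.homo _ _) (trans (cong₂ G._+_ e (r.⁻¹-homo n′)) (G.inverseʳ _)))

  embed-additive : Additive G quotient (proj₁ embed)
  embed-additive =
    surjective-elim r-surjective (λ _ → Π-irrelevant ua λ _ → Quotient-UIP) λ n →
    surjective-elim r-surjective (λ _ → Quotient-UIP) λ n′ → begin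
      proj₁ embed (⟦ r ⟧ n G.+ ⟦ r ⟧ n′)               ≡⟨ cong (proj₁ embed) (sym (r.homo n n′)) ⟩
      proj₁ embed (⟦ r ⟧ (n N.+ n′))                   ≡⟨ proj₂ embed _ ⟩
      [ ⟦ ι ⟧ (n N.+ n′) ]                             ≡⟨ cong [_] (ι.homo n n′) ⟩
      [ ⟦ ι ⟧ n M.+ ⟦ ι ⟧ n′ ]                         ≡⟨ sym ([]-+ _ _) ⟩
      [ ⟦ ι ⟧ n ] ⊞ [ ⟦ ι ⟧ n′ ]                       ≡⟨ sym (cong₂ _⊞_ (proj₂ embed n) (proj₂ embed n′)) ⟩
      proj₁ embed (⟦ r ⟧ n) ⊞ proj₁ embed (⟦ r ⟧ n′)   ∎

  -- If `ι n` and `ι n′` have the same class, they differ by `ι d` with `⟦ r ⟧ d` zero; injectivity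
  -- of `ι` carries this back to `N`.
  embed-injective : ∀ x y → proj₁ embed x ≡ proj₁ embed y → x ≡ y
  embed-injective =
    surjective-elim r-surjective (λ _ → Π-irrelevant ua λ _ → Π-irrelevant ua λ _ → G.isSet) λ n →
    surjective-elim r-surjective (λ _ → Π-irrelevant ua λ _ → G.isSet) λ n′ e →
    let (d , hd , rd≡0) = ≡⇒∼ (trans (sym (proj₂ embed n)) (trans e (proj₂ embed n′)))
    in begin
      ⟦ r ⟧ n                  ≡⟨ cong ⟦ r ⟧ (sym (se.injective (trans (ι.homo d n′) hd))) ⟩
      ⟦ r ⟧ (d N.+ n′)         ≡⟨ r.homo d n′ ⟩
      ⟦ r ⟧ d G.+ ⟦ r ⟧ n′     ≡⟨ cong (G._+ _) rd≡0 ⟩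
      G.0# G.+ ⟦ r ⟧ n′        ≡⟨ G.identityˡ _ ⟩
      ⟦ r ⟧ n′                 ∎

  opaque
    pushout : AbSES B G
    pushout = record
      { middle = quotient
      ; inclusion = additive⇒hom G quotient (proj₁ embed) embed-additive
      ; projection = additive⇒hom quotient B proj₁
          (elim (λ _ → Π-irrelevant ua λ _ → B.isSet) λ x → elim (λ _ → B.isSet) λ y →
            begin
            proj₁ ([ x ] ⊞ [ y ])               ≡⟨ cong proj₁ ([]-+ x y) ⟩
            proj₁ [ x M.+ y ]                   ≡⟨ image-[] _ ⟩
            ⟦ ρ ⟧ (x M.+ y)                     ≡⟨ ρ.homo x y ⟩
            ⟦ ρ ⟧ x B.+ ⟦ ρ ⟧ y                 ≡⟨ sym (cong₂ B._+_ (image-[] x) (image-[] y)) ⟩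
            proj₁ [ x ] B.+ proj₁ [ y ]         ∎)
      ; isShortExact = record
        { injective = embed-injective _ _
        ; surjective = λ b → ∥∥-map (λ { (m , e) → [ m ] , trans (image-[] m) e }) (se.surjective b)
        ; zero = zero
        -- A representative `m` of `c` lies over zero, hence is some `ι n`, and `c` is the image of
        -- `⟦ r ⟧ n`.
        ; exact = λ { (c , e) → ∥∥-map (λ { (m , h) →
            let (n , ιn≡m) = kernel-lift se m (trans (sym (image-[] m)) (trans (cong proj₁ h) e)) in
            ⟦ r ⟧ n , Σ-≡-irrelevant (λ _ → B.isSet)
              (trans (proj₂ embed n) (trans (cong [_] ιn≡m) h)) }) ([]-surjective c) }
        }
      }
      where
      zero : ∀ x → proj₁ (proj₁ embed x) ≡ B.0#
      zero = surjective-elim r-surjective (λ _ → B.isSet) λ n →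
        trans (cong proj₁ (proj₂ embed n)) (trans (image-[] _) (se.zero n))

    toPushout : M →ᴳ middle pushout
    toPushout = additive⇒hom M quotient [_] (λ m m′ → sym ([]-+ m m′))

    toPushout-inclusion : ∀ n → ⟦ inclusion pushout ⟧ (⟦ r ⟧ n) ≡ ⟦ toPushout ⟧ (⟦ ι ⟧ n)
    toPushout-inclusion = proj₂ embed

    toPushout-projection : ∀ m → ⟦ projection pushout ⟧ (⟦ toPushout ⟧ m) ≡ ⟦ ρ ⟧ m
    toPushout-projection = image-[]

    -- The map `f` kills `ι` of the kernel of `r`, so it descends to the quotient; the descended map
    -- is a morphism of extensions and therefore comes from a path.
    pushout-unique : (T : AbSES B G) (f : M →ᴳ middle T) →
                     (∀ n → ⟦ f ⟧ (⟦ ι ⟧ n) ≡ ⟦ inclusion T ⟧ (⟦ r ⟧ n)) →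
                     (∀ m → ⟦ projection T ⟧ (⟦ f ⟧ m) ≡ ⟦ ρ ⟧ m) → pushout ≡ T
    pushout-unique T f fι≡r f≡ρ = proj₁ (morphism⇒fibre ua pushout T {g} (mkIsMorphism
      (elim (λ _ → Π-irrelevant ua λ _ → T.isSet) λ x → elim (λ _ → T.isSet) λ y → begin
        g ([ x ] ⊞ [ y ])        ≡⟨ cong g ([]-+ x y) ⟩
        g [ x M.+ y ]            ≡⟨ g[] _ ⟩
        ⟦ f ⟧ (x M.+ y)          ≡⟨ f.homo x y ⟩
        ⟦ f ⟧ x T.+ ⟦ f ⟧ y      ≡⟨ sym (cong₂ T._+_ (g[] x) (g[] y)) ⟩
        g [ x ] T.+ g [ y ]      ∎)
      (surjective-elim r-surjective (λ _ → T.isSet) λ n →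
        trans (cong g (proj₂ embed n)) (trans (g[] _) (fι≡r n)))
      (elim (λ _ → B.isSet) λ m →
        trans (cong ⟦ projection T ⟧ (g[] m)) (trans (f≡ρ m) (sym (image-[] m))))))
      where
      module T = AbGroup (middle T)
      module f = _→ᴳ_ f

      respects : ∀ m m′ → m ∼ m′ → ⟦ f ⟧ m ≡ ⟦ f ⟧ m′
      respects _ m′ (n , refl , rn≡0) = begin
        ⟦ f ⟧ (⟦ ι ⟧ n M.+ m′)           ≡⟨ f.homo _ _ ⟩
        ⟦ f ⟧ (⟦ ι ⟧ n) T.+ ⟦ f ⟧ m′     ≡⟨ cong (T._+ ⟦ f ⟧ m′) (begin
          ⟦ f ⟧ (⟦ ι ⟧ n)                  ≡⟨ fι≡r n ⟩
          ⟦ inclusion T ⟧ (⟦ r ⟧ n)        ≡⟨ cong ⟦ inclusion T ⟧ rn≡0 ⟩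
          ⟦ inclusion T ⟧ G.0#             ≡⟨ _→ᴳ_.ε-homo (inclusion T) ⟩
          T.0#                             ∎) ⟩
        T.0# T.+ ⟦ f ⟧ m′                ≡⟨ T.identityˡ _ ⟩
        ⟦ f ⟧ m′                         ∎

      descent : Σ[ g ∈ (Quotient → T.Carrier) ] (∀ m → g [ m ] ≡ ⟦ f ⟧ m)
      descent = descend ua []-surjective T.isSet ⟦ f ⟧ (λ m m′ → respects m m′ ∘ ≡⇒∼)

      g : Quotient → T.Carrier
      g = proj₁ descent

      g[] : ∀ m → g [ m ] ≡ ⟦ f ⟧ m
      g[] = proj₂ descent

-- The fibre sequence

module _ (ua : Univalence) {A E B : AbGroup ℓ} {i : A →ᴳ E} {p : E →ᴳ B}
         (se : IsShortExact i p) (G : AbGroup ℓ) where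
  private
    module se = IsShortExact se
    module B = AbGroup B
    module G = AbGroup G

  -- The null-homotopy of the composite

  module _ (S : AbSES B G) where
    private
      module S = AbSES S
      S″ = pullback i (pullback p S)

    underlying : Carrier (middle S″) → Carrier S.middle
    underlying n = proj₁ (proj₁ (proj₁ (proj₁ n)))

    -- The component in the middle group of `S` lies over `p (i a)`, which is zero, so it comes from
    -- `G`.
    underlying-lift : ∀ n → fibre ⟦ S.inclusion ⟧ (underlying n)
    underlying-lift ((((c , _) , pc≡pe) , a) , e≡ia) =
      kernel-lift S.isShortExact c (trans pc≡pe (trans (cong ⟦ p ⟧ e≡ia) (se.zero a)))

    splitting : Carrier (middle S″) → G.Carrier × Carrier A
    splitting n = proj₁ (underlying-lift n) , proj₂ (proj₁ n)

    splitting-isMorphism : IsMorphism S″ (trivial A G) splitting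
    splitting-isMorphism = mkIsMorphism
      (λ n n′ → cong (_, _) (S.injective (begin
        ⟦ S.inclusion ⟧ (proj₁ (underlying-lift (n +″ n′)))
          ≡⟨ proj₂ (underlying-lift (n +″ n′)) ⟩
        underlying n M.+ underlying n′
          ≡⟨ sym (cong₂ M._+_ (proj₂ (underlying-lift n)) (proj₂ (underlying-lift n′))) ⟩
        ⟦ S.inclusion ⟧ (proj₁ (underlying-lift n)) M.+ ⟦ S.inclusion ⟧ (proj₁ (underlying-lift n′))
          ≡⟨ sym (_→ᴳ_.homo S.inclusion _ _) ⟩
        ⟦ S.inclusion ⟧ (proj₁ (underlying-lift n) G.+ proj₁ (underlying-lift n′)) ∎)))
      (λ x → cong (_, _) (S.injective (proj₂ (underlying-lift (⟦ inclusion S″ ⟧ x)))))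
      (λ _ → refl)
      where
      module M = AbGroup S.middle
      open AbGroup (middle S″) using () renaming (_+_ to _+″_)

    opaque
      composite-trivial : S″ ≡ trivial A G
      composite-trivial = proj₁ (morphism⇒fibre ua S″ (trivial A G) splitting-isMorphism)

      idToMap-composite-trivial : ∀ n → idToMap composite-trivial n ≡ splitting n
      idToMap-composite-trivial =
        cong-app (proj₂ (morphism⇒fibre ua S″ (trivial A G) splitting-isMorphism))

    -- Allows any preimage in `G` to replace the one chosen by `underlying-lift`.
    idToMap-composite-trivial-unique : ∀ n x → ⟦ S.inclusion ⟧ x ≡ underlying n →
      idToMap composite-trivial n ≡ (x , proj₂ (proj₁ n))
    idToMap-composite-trivial-unique n x e = trans (idToMap-composite-trivial n)
      (cong (_, _) (S.injective (trans (proj₂ (underlying-lift n)) (sym e))))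

  -- `P` and `Q` are arbitrary paths with a prescribed action on elements, so `pullback-trivial` is
  -- never unfolded.
  composite-trivial-pointed :
    (P : pullback p (trivial B G) ≡ trivial E G) (Q : pullback i (trivial E G) ≡ trivial A G) →
    (∀ n → idToMap P n ≡ (proj₁ (proj₁ (proj₁ n)) , proj₂ (proj₁ n))) →
    (∀ n → idToMap Q n ≡ (proj₁ (proj₁ (proj₁ n)) , proj₂ (proj₁ n))) →
    composite-trivial (trivial B G) ≡ trans (cong (pullback i) P) Q
  composite-trivial-pointed P Q P-map Q-map = idToMap-injective ua λ n →
    let ((((x , b) , e) , b≡pe) , a) , e≡ia = n in begin
      idToMap (composite-trivial (trivial B G)) n
        ≡⟨ idToMap-composite-trivial-unique (trivial B G) n x
             -- The inclusion of `x` is `x` paired with zero, so `b` has to vanish: it is `p e` with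
             -- `e` in the image of `i`.
             (cong (x ,_) (sym (trans b≡pe (trans (cong ⟦ p ⟧ e≡ia) (se.zero a))))) ⟩
      x , a
        ≡⟨ cong (λ z → proj₁ z , a) (sym (P-map (proj₁ (proj₁ n)))) ⟩
      proj₁ (idToMap P (proj₁ (proj₁ n))) , a
        ≡⟨ cong (λ z → proj₁ (proj₁ z) , proj₂ z) (sym (idToMap-cong-pullback i P n)) ⟩
      _
        ≡⟨ sym (Q-map (idToMap (cong (pullback i) P) n)) ⟩
      idToMap Q (idToMap (cong (pullback i) P) n)
        ≡⟨ sym (idToMap-trans (cong (pullback i) P) Q n) ⟩
      idToMap (trans (cong (pullback i) P) Q) n ∎

  -- Gives the path condition in the fibre of `pullback i`. The components in `A` agree because `α`
  -- respects projections; those in `G` agree by the hypothesis, tested inside `T`.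
  composite-trivial-natural :
    (F : AbSES E G) (α : pullback i F ≡ trivial A G) (T : AbSES B G) (β : F ≡ pullback p T) →
    (∀ n → proj₁ (proj₁ (idToMap β (proj₁ (proj₁ n)))) ≡ ⟦ inclusion T ⟧ (proj₁ (idToMap α n))) →
    trans (cong (pullback i) β) (composite-trivial T) ≡ α
  composite-trivial-natural F α T β β≡α = idToMap-injective ua λ n → begin
    idToMap (trans (cong (pullback i) β) (composite-trivial T)) n
      ≡⟨ idToMap-trans (cong (pullback i) β) (composite-trivial T) n ⟩
    idToMap (composite-trivial T) (idToMap (cong (pullback i) β) n)
      ≡⟨ idToMap-composite-trivial-unique T (idToMap (cong (pullback i) β) n) (proj₁ (idToMap α n))
           (trans (sym (β≡α n))
                  (cong (proj₁ ∘ proj₁ ∘ proj₁) (sym (idToMap-cong-pullback i β n)))) ⟩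
    proj₁ (idToMap α n) , proj₂ (proj₁ (idToMap (cong (pullback i) β) n))
      ≡⟨ cong (λ z → proj₁ (idToMap α n) , proj₂ z) (idToMap-cong-pullback i β n) ⟩
    proj₁ (idToMap α n) , proj₂ (proj₁ n)
      ≡⟨ cong (proj₁ (idToMap α n) ,_) (sym (commutesProjection (idToMap-isMorphism α) n)) ⟩
    idToMap α n ∎

  nullhomotopy : (pullback∙ ua i G ∘∙ pullback∙ ua p G) ∼∙ const∙
  nullhomotopy = composite-trivial , trans (trans-reflʳ (composite-trivial (trivial B G)))
    (composite-trivial-pointed (pullback-trivial ua {X = G} p) (pullback-trivial ua {X = G} i)
      (idToMap-pullback-trivial {Y = B} {X = G} ua p) (idToMap-pullback-trivial {Y = E} {X = G} ua i))

  -- Descent of an extension whose pullback along `i` is trivialised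

  module Descent (F : AbSES E G) (α : pullback i F ≡ trivial A G) where
    private
      module F = AbSES F
      module α = IsMorphism (idToMap-isMorphism α)
      N = middle (pullback i F)

    kernelInclusion : N →ᴳ F.middle
    kernelInclusion = additive⇒hom N F.middle (proj₁ ∘ proj₁) (λ _ _ → refl)

    base : F.middle →ᴳ B
    base = additive⇒hom F.middle B (⟦ p ⟧ ∘ ⟦ F.projection ⟧)
      (λ _ _ → trans (cong ⟦ p ⟧ (_→ᴳ_.homo F.projection _ _)) (_→ᴳ_.homo p _ _))

    -- The component in `A` is determined by the one in `F` because `i` is injective, and it exists
    -- over the kernel of `base` by exactness of `i` and `p`.
    base-isShortExact : IsShortExact kernelInclusion base
    base-isShortExact = record
      { injective = λ { {(_ , _) , e} {(_ , _) , e′} h → Σ-≡-irrelevant (λ _ → isSet E)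
          (cong₂ _,_ h (se.injective (trans (sym e) (trans (cong ⟦ F.projection ⟧ h) e′)))) }
      ; surjective = λ b P irr k → se.surjective b P irr λ { (e , h) →
          F.surjective e P irr λ { (m , h′) → k (m , trans (cong ⟦ p ⟧ h′) h) } }
      ; zero = λ { ((_ , a) , e) → trans (cong ⟦ p ⟧ e) (se.zero a) }
      ; exact = λ { (m , h) P irr k → let (a , ia≡qm) = kernel-lift se (⟦ F.projection ⟧ m) h in
          k (((m , a) , sym ia≡qm) , Σ-≡-irrelevant (λ _ → B.isSet) refl) }
      }

    retraction : N →ᴳ G
    retraction = additive⇒hom N G (proj₁ ∘ idToMap α) (λ x y → cong proj₁ (α.additive x y))

    retraction-inclusion : ∀ x → ⟦ retraction ⟧ (⟦ inclusion (pullback i F) ⟧ x) ≡ x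
    retraction-inclusion x = cong proj₁ (α.commutesInclusion x)

    retraction-surjective : IsSurjective ⟦ retraction ⟧
    retraction-surjective x P irr k = k (_ , retraction-inclusion x)

    open Pushout ua base-isShortExact retraction retraction-surjective public

    -- The class map lies over `p`, and it is compatible with the inclusions of `G` because
    -- `retraction` is the identity on `G`.
    pushout-path : Σ[ β ∈ F ≡ pullback p pushout ]
                   (∀ m → proj₁ (proj₁ (idToMap β m)) ≡ ⟦ toPushout ⟧ m)
    pushout-path = pullback-unique ua p F pushout toPushout
      (λ x → trans (sym (toPushout-inclusion (⟦ inclusion (pullback i F) ⟧ x)))
                   (cong ⟦ inclusion pushout ⟧ (retraction-inclusion x)))
      toPushout-projection

    -- The condition for naturality is the commuting square of the pushout, whose top map is the
    -- first component of `α`.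
    composite-trivial-pushout :
      trans (cong (pullback i) (proj₁ pushout-path)) (composite-trivial pushout) ≡ α
    composite-trivial-pushout = composite-trivial-natural F α pushout (proj₁ pushout-path) λ n →
      trans (proj₂ pushout-path (proj₁ (proj₁ n))) (sym (toPushout-inclusion n))

    toFibre-pushout : toFibre (pullback∙ ua p G) (pullback∙ ua i G) nullhomotopy pushout ≡ (F , α)
    toFibre-pushout = sym (fibre-≡ {f = pullback i} {y = trivial A G}
      (proj₁ pushout-path) composite-trivial-pushout)

  -- Descent and pullback are mutually inverse

  opaque
    descent : fibre (pullback i) (trivial A G) → AbSES B G
    descent (F , α) = Descent.pushout F α

    toFibre-descent : ∀ x →
      toFibre (pullback∙ ua p G) (pullback∙ ua i G) nullhomotopy (descent x) ≡ x
    toFibre-descent (F , α) = Descent.toFibre-pushout F α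

    -- The first projection from `pullback p S` to `S` satisfies the universal property of the
    -- pushout: on the kernel it is the retraction followed by the inclusion of `G`.
    descent-pullback : ∀ S → descent (pullback p S , composite-trivial S) ≡ S
    descent-pullback S = Descent.pushout-unique (pullback p S) (composite-trivial S) S
      (additive⇒hom (middle (pullback p S)) (middle S) (proj₁ ∘ proj₁) (λ _ _ → refl))
      (λ n → sym (trans (cong (⟦ inclusion S ⟧ ∘ proj₁) (idToMap-composite-trivial S n))
                        (proj₂ (underlying-lift S n))))
      -- Compatibility with the projections is the defining equation of the fibre product.
      proj₂

  toFibre-isEquiv : IsEquiv (toFibre (pullback∙ ua p G) (pullback∙ ua i G) nullhomotopy)
  toFibre-isEquiv = quasiInverse⇒isEquiv
    (toFibre (pullback∙ ua p G) (pullback∙ ua i G) nullhomotopy)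
    descent toFibre-descent descent-pullback

theorem13 : (ua : Univalence) {ℓ : Level} (A E B : AbGroup ℓ)
    (i : A →ᴳ E) (p : E →ᴳ B) → IsShortExact i p →
    (G : AbGroup ℓ) →
    IsFibreSequence (pullback∙ ua p G) (pullback∙ ua i G)
theorem13 ua A E B i p se G = nullhomotopy ua se G , toFibre-isEquiv ua se G
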